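{- For every graph $G$ of order $n$ and every $2\le k\le n$, $\lambda_k(\overleftrightarrow{G})\ge \lambda_k(G)$. Moreover, this bound is sharp. In particular, $\lambda_2(\overleftrightarrow{G})=\lambda_2(G)$.
   Context: Graphs are finite simple undirected. $\overleftrightarrow{G}$ is the symmetric digraph obtained from $G$ by replacing each edge $xy$ by the two arcs $xy$ and $yx$. For a graph $G$ and $S\subseteq V(G)$ with $|S|\ge 2$, an $S$-tree is a subtree of $G$ containing $S$; $\lambda_S(G)$ is the maximum number of pairwise edge-disjoint $S$-trees, and $\lambda_k(G)=\min\{\lambda_S(G):S\subseteq V(G),|S|=k\}$ (generalized $k$-edge-connectivity; $\lambda_2(G)$ is the edge-connectivity). For a digraph $D$ and $S\subseteq V(D)$, $\lambda_S(D)$ is the maximum number of pairwise arc-disjoint strong subgraphs of $D$ containing $S$, and $\lambda_k(D)=\min\{\lambda_S(D): S\subseteq V(D), |S|=k\}$. -}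

module Defs where

open import Data.Bool using (true; false)
open import Data.Fin using (Fin; zero; suc; combine)
open import Data.Fin.Properties using (any?; all?; injective⇒≤; combine-injective; suc-injective) renaming (_≟_ to _≟ᶠ_)
open import Data.Fin.Subset using (Subset; _∈_; _⊆_; ∣_∣; Nonempty; ⁅_⁆; _∪_; ⊥)
open import Data.Fin.Subset.Properties using (_∈?_; nonempty?; anySubset?; ∣p∣≤n; p⊂q⇒∣p∣<∣q∣; p⊆p∪q; q⊆p∪q; x∈p∪q⁻; x∈⁅x⁆; x∈⁅y⁆⇒x≡y; ∣⊥∣≡0)
open import Data.List using (List; []; _∷_; length; _∷ʳ_)
import Data.List as List
import Data.List.Membership.Propositional.Properties as ∈ₚ
import Data.List.Relation.Unary.All as All
open import Data.List.Relation.Unary.AllPairs using ([]; _∷_)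
open import Data.List.Relation.Unary.Linked using (Linked; linked?)
open import Data.List.Relation.Unary.Unique.Propositional using (Unique)
import Data.List.Relation.Unary.AllPairs as AllPairs
open import Data.Nat using (ℕ; zero; suc; _+_; _*_; _≤_; _<_; z≤n; s≤s; _≤?_; _≟_)
open import Data.Nat.Properties using (≤-trans; ≤-antisym; ≤-<-trans; <-≤-trans; <-irrefl; n≤1+n; m≤m+n; m≤n⇒m<n∨m≡n; +-suc; +-monoʳ-≤)
open import Data.Product using (∃; _×_; _,_; proj₁; proj₂)
open import Data.Sum using (inj₁; inj₂)
open import Data.Vec using (Vec; []; _∷_; lookup; tabulate; here; there)
open import Data.Vec.Properties using (lookup∘tabulate)
open import Function using (_∘_)
open import Level using (0ℓ)
open import Relation.Binary.Construct.Closure.ReflexiveTransitive using (Star; ε; _◅_; _◅◅_)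
open import Relation.Binary.Core using (Rel)
open import Relation.Binary.Definitions using (Decidable)
open import Relation.Binary.PropositionalEquality using (_≡_; _≢_; refl; sym; cong; subst; subst₂)
open import Relation.Nullary using (¬_; Dec; yes; no; contradiction)
open import Relation.Nullary.Decidable using (map′; ¬?; _×-dec_; _→-dec_)
import Relation.Unary as U

-- The x-th entry is the set of heads of arcs with tail x.
Arcs : ℕ → Set
Arcs n = Vec (Subset n) n

infix 4 _⟶_∈_
_⟶_∈_ : ∀ {n} → Fin n → Fin n → Arcs n → Set
x ⟶ y ∈ A = y ∈ lookup A x

Arc : ∀ {n} → Arcs n → Rel (Fin n) 0ℓ
Arc A x y = x ⟶ y ∈ A

record Digraph (n : ℕ) : Set where
  field
    arcs     : Arcs n
    loopless : ∀ x → ¬ (x ⟶ x ∈ arcs)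

-- An edge xy is recorded as both x ⟶ y and y ⟶ x.
record Graph (n : ℕ) : Set where
  field
    edges     : Arcs n
    symmetric : ∀ x y → x ⟶ y ∈ edges → y ⟶ x ∈ edges
    loopless  : ∀ x → ¬ (x ⟶ x ∈ edges)

-- Each edge xy of G contributes the two arcs xy and yx; these are exactly
-- the two entries by which the edge is recorded in G.
symmetricDigraph : ∀ {n} → Graph n → Digraph n
symmetricDigraph G = record { arcs = Graph.edges G ; loopless = Graph.loopless G }

-- Candidate subgraphs of a (di)graph with vertex set Fin n.
record Sub (n : ℕ) : Set where
  constructor sub
  field
    verts : Subset n
    arcs  : Arcs n
open Sub public

record _IsSubgraphOf_ {n} (H : Sub n) (A : Arcs n) : Set where
  constructor isSubgraph
  field
    arcs⊆ : ∀ x y → x ⟶ y ∈ arcs H → x ⟶ y ∈ A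
    ends∈ : ∀ x y → x ⟶ y ∈ arcs H → x ∈ verts H × y ∈ verts H

Symmetric : ∀ {n} → Sub n → Set
Symmetric H = ∀ x y → x ⟶ y ∈ arcs H → y ⟶ x ∈ arcs H

-- Every ordered pair of vertices is joined by a (directed) walk.
-- For symmetric H this is connectedness of the undirected graph H.
Connected : ∀ {n} → Sub n → Set
Connected H = ∀ x y → x ∈ verts H → y ∈ verts H → Star (Arc (arcs H)) x y

-- A cycle x, xs, x with at least three vertices, all distinct.
Cycle : ∀ {n} → Sub n → Set
Cycle {n} H = ∃ λ (x : Fin n) → ∃ λ (xs : List (Fin n)) →
  2 ≤ length xs × Unique (x ∷ xs) × Linked (Arc (arcs H)) (x ∷ xs ∷ʳ x)

record IsSTree {n} (G : Graph n) (S : Subset n) (H : Sub n) : Set where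
  constructor isSTree
  field
    subgraph   : H IsSubgraphOf Graph.edges G
    undirected : Symmetric H
    nonempty   : Nonempty (verts H)
    connected  : Connected H
    acyclic    : ¬ Cycle H
    contains   : S ⊆ verts H

record IsStrongSubgraph {n} (D : Digraph n) (S : Subset n) (H : Sub n) : Set where
  constructor isStrong
  field
    subgraph : H IsSubgraphOf Digraph.arcs D
    nonempty : Nonempty (verts H)
    strong   : Connected H
    contains : S ⊆ verts H

-- Arc-disjointness; for symmetric subgraphs this is edge-disjointness.
Disjoint : ∀ {n} → Sub n → Sub n → Set
Disjoint H K = ∀ x y → x ⟶ y ∈ arcs H → ¬ (x ⟶ y ∈ arcs K)

Packing : ∀ {n} → (Sub n → Set) → ℕ → Set
Packing {n} P m = ∃ λ (H : Fin m → Sub n) →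
  (∀ i → P (H i)) × (∀ i j → i ≢ j → Disjoint (H i) (H j))

IsMaximum : (ℕ → Set) → ℕ → Set
IsMaximum P m = P m × (∀ l → P l → l ≤ m)

IsMinimum : (ℕ → Set) → ℕ → Set
IsMinimum P m = P m × (∀ l → P l → m ≤ l)

Isλ-S : ∀ {n} → (Subset n → Sub n → Set) → Subset n → ℕ → Set
Isλ-S P S = IsMaximum (Packing (P S))

Isλ-k : ∀ {n} → (Subset n → Sub n → Set) → ℕ → ℕ → Set
Isλ-k P k = IsMinimum (λ v → ∃ λ S → ∣ S ∣ ≡ k × Isλ-S P S v)

-- The extrema exist and are unique (proved next), which turns the
-- relations above into the functions λᵍ and λᵈ at the end of this file.

isMaximum-unique : ∀ {P a b} → IsMaximum P a → IsMaximum P b → a ≡ b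
isMaximum-unique (pa , ma) (pb , mb) = ≤-antisym (mb _ pa) (ma _ pb)

isMinimum-unique : ∀ {P a b} → IsMinimum P a → IsMinimum P b → a ≡ b
isMinimum-unique (pa , ma) (pb , mb) = ≤-antisym (ma _ pb) (mb _ pa)

maximum-exists : ∀ {P : ℕ → Set} → U.Decidable P → P 0 →
                 ∀ b → (∀ l → P l → l ≤ b) → ∃ (IsMaximum P)
maximum-exists P? p0 zero    bd = 0 , p0 , bd
maximum-exists {P} P? p0 (suc b) bd with P? (suc b)
... | yes p = suc b , p , bd
... | no ¬p = maximum-exists P? p0 b bd′
  where
  bd′ : ∀ l → P l → l ≤ b
  bd′ l pl with m≤n⇒m<n∨m≡n (bd l pl)
  ... | inj₁ (s≤s l≤b) = l≤b
  ... | inj₂ refl      = contradiction pl ¬p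

minimum-exists : ∀ {P : ℕ → Set} → U.Decidable P → ∀ v → P v → ∃ (IsMinimum P)
minimum-exists {P} P? zero    pv = 0 , pv , λ _ _ → z≤n
minimum-exists {P} P? (suc v) pv with P? 0
... | yes p = 0 , p , λ _ _ → z≤n
... | no ¬p with minimum-exists {P ∘ suc} (P? ∘ suc) v pv
...   | m , pm , least = suc m , pm , least′
  where
  least′ : ∀ l → P l → suc m ≤ l
  least′ zero    p0 = contradiction p0 ¬p
  least′ (suc l) pl = s≤s (least l pl)

anyVec? : ∀ {A : Set} → (∀ {P : A → Set} → U.Decidable P → Dec (∃ P)) →
          ∀ m {P : Vec A m → Set} → U.Decidable P → Dec (∃ P)
anyVec? s zero P? = map′ ([] ,_) (λ { ([] , p) → p }) (P? [])
anyVec? s (suc m) P? =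
  map′ (λ { (x , xs , p) → x ∷ xs , p }) (λ { (x ∷ xs , p) → x , xs , p })
       (s λ x → anyVec? s m λ xs → P? (x ∷ xs))

anySub? : ∀ {n} {P : Sub n → Set} → U.Decidable P → Dec (∃ P)
anySub? {n} P? =
  map′ (λ { (V , A , p) → sub V A , p }) (λ { (sub V A , p) → V , A , p })
       (anySubset? λ V → anyVec? anySubset? n λ A → P? (sub V A))

anyList? : ∀ {n} b {P : List (Fin n) → Set} → U.Decidable P →
           (∀ xs → P xs → length xs ≤ b) → Dec (∃ P)
anyList? zero P? bd =
  map′ ([] ,_)
       (λ { ([] , p) → p ; (x ∷ xs , p) → contradiction (bd (x ∷ xs) p) λ () })
       (P? [])
anyList? (suc b) {P} P? bd with P? []
... | yes p = yes ([] , p)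
... | no ¬p =
  map′ (λ { (x , xs , p) → x ∷ xs , p })
       (λ { ([] , p) → contradiction p ¬p ; (x ∷ xs , p) → x , xs , p })
       (any? λ x → anyList? b (λ xs → P? (x ∷ xs)) (λ xs p → pred (bd (x ∷ xs) p)))
  where
  pred : ∀ {a c} → suc a ≤ suc c → a ≤ c
  pred (s≤s q) = q

module _ {n} {R : Rel (Fin n) 0ℓ} (R? : Decidable R) where

  closure : ∀ x fuel (p : Subset n) → n ≤ fuel + ∣ p ∣ → x ∈ p →
            (∀ y → y ∈ p → Star R x y) →
            ∃ λ (q : Subset n) → x ∈ q × (∀ y → y ∈ q → Star R x y) ×
                                 (∀ y z → y ∈ q → R y z → z ∈ q)
  closure x fuel p n≤ x∈p r
    with any? (λ y → any? (λ z → y ∈? p ×-dec (R? y z ×-dec ¬? (z ∈? p))))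
  ... | no ¬∃ = p , x∈p , r , closed
    where
    closed : ∀ y z → y ∈ p → R y z → z ∈ p
    closed y z y∈p yz with z ∈? p
    ... | yes z∈p = z∈p
    ... | no z∉p  = contradiction (y , z , y∈p , yz , z∉p) ¬∃
  ... | yes (y , z , y∈p , yz , z∉p) = grow fuel n≤
    where
    p′ : Subset n
    p′ = p ∪ ⁅ z ⁆
    p<p′ : ∣ p ∣ < ∣ p′ ∣
    p<p′ = p⊂q⇒∣p∣<∣q∣ (p⊆p∪q ⁅ z ⁆ , z , q⊆p∪q p ⁅ z ⁆ (x∈⁅x⁆ z) , z∉p)
    r′ : ∀ w → w ∈ p′ → Star R x w
    r′ w w∈ with x∈p∪q⁻ p ⁅ z ⁆ w∈
    ... | inj₁ w∈p = r w w∈p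
    ... | inj₂ w∈z with x∈⁅y⁆⇒x≡y z w∈z
    ...   | refl = r y y∈p ◅◅ (yz ◅ ε)
    grow : ∀ f → n ≤ f + ∣ p ∣ →
           ∃ λ (q : Subset n) → x ∈ q × (∀ y → y ∈ q → Star R x y) ×
                                (∀ y z → y ∈ q → R y z → z ∈ q)
    grow zero    h = contradiction (<-≤-trans (≤-<-trans h p<p′) (∣p∣≤n p′)) (<-irrefl refl)
    grow (suc f) h = closure x f p′
      (≤-trans h (subst (_≤ f + ∣ p′ ∣) (+-suc f ∣ p ∣) (+-monoʳ-≤ f p<p′)))
      (p⊆p∪q ⁅ z ⁆ x∈p) r′

  star? : Decidable (Star R)
  star? x y with closure x n ⁅ x ⁆ (m≤m+n n _) (x∈⁅x⁆ x) start
    where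
    start : ∀ y → y ∈ ⁅ x ⁆ → Star R x y
    start y y∈ with x∈⁅y⁆⇒x≡y x y∈
    ... | refl = ε
  ... | q , x∈q , sound , closed = map′ (sound y) (stay x∈q) (y ∈? q)
    where
    stay : ∀ {u v} → u ∈ q → Star R u v → v ∈ q
    stay u∈ ε        = u∈
    stay u∈ (e ◅ es) = stay (closed _ _ u∈ e) es

unique-length : ∀ {n} (xs : List (Fin n)) → Unique xs → length xs ≤ n
unique-length {n} xs u = injective⇒≤ (inj xs u)
  where
  inj : ∀ xs → Unique xs → ∀ {i j} → List.lookup xs i ≡ List.lookup xs j → i ≡ j
  inj (x ∷ xs) (_ ∷ _) {zero}  {zero}  _  = refl
  inj (x ∷ xs) (d ∷ _) {zero}  {suc j} eq = contradiction eq (All.lookup d (∈ₚ.∈-lookup j))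
  inj (x ∷ xs) (d ∷ _) {suc i} {zero}  eq = contradiction (sym eq) (All.lookup d (∈ₚ.∈-lookup i))
  inj (x ∷ xs) (_ ∷ u) {suc i} {suc j} eq = cong suc (inj xs u eq)

arc? : ∀ {n} (A : Arcs n) → Decidable (Arc A)
arc? A x y = y ∈? lookup A x

all₂? : ∀ {n} {P : Fin n → Fin n → Set} → Decidable P → Dec (∀ x y → P x y)
all₂? P? = all? λ x → all? λ y → P? x y

isSubgraph? : ∀ {n} (H : Sub n) (A : Arcs n) → Dec (H IsSubgraphOf A)
isSubgraph? H A =
  map′ (λ { (a , e) → isSubgraph a e }) (λ { (isSubgraph a e) → a , e })
    (all₂? (λ x y → arc? (arcs H) x y →-dec arc? A x y)
     ×-dec all₂? (λ x y → arc? (arcs H) x y →-dec (x ∈? verts H ×-dec y ∈? verts H)))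

symmetric? : ∀ {n} (H : Sub n) → Dec (Symmetric H)
symmetric? H = all₂? λ x y → arc? (arcs H) x y →-dec arc? (arcs H) y x

connected? : ∀ {n} (H : Sub n) → Dec (Connected H)
connected? H = all₂? λ x y →
  x ∈? verts H →-dec (y ∈? verts H →-dec star? (arc? (arcs H)) x y)

cycle? : ∀ {n} (H : Sub n) → Dec (Cycle H)
cycle? {n} H = any? λ x → anyList? n
  (λ xs → 2 ≤? length xs
          ×-dec (AllPairs.allPairs? (λ a b → ¬? (a ≟ᶠ b)) (x ∷ xs)
          ×-dec linked? (arc? (arcs H)) (x ∷ xs ∷ʳ x)))
  (λ { xs (_ , u , _) → ≤-trans (n≤1+n _) (unique-length (x ∷ xs) u) })

contains? : ∀ {n} (S : Subset n) (H : Sub n) → Dec (∀ x → x ∈ S → x ∈ verts H)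
contains? S H = all? λ x → x ∈? S →-dec x ∈? verts H

isSTree? : ∀ {n} (G : Graph n) S → U.Decidable (IsSTree G S)
isSTree? G S H =
  map′ (λ { (a , b , c , d , e , f) → isSTree a b c d e (f _) })
       (λ { (isSTree a b c d e f) → a , b , c , d , e , λ _ → f })
    (isSubgraph? H (Graph.edges G) ×-dec (symmetric? H ×-dec (nonempty? (verts H)
     ×-dec (connected? H ×-dec (¬? (cycle? H) ×-dec contains? S H)))))

isStrongSubgraph? : ∀ {n} (D : Digraph n) S → U.Decidable (IsStrongSubgraph D S)
isStrongSubgraph? D S H =
  map′ (λ { (a , b , c , d) → isStrong a b c (d _) })
       (λ { (isStrong a b c d) → a , b , c , λ _ → d })
    (isSubgraph? H (Digraph.arcs D) ×-dec (nonempty? (verts H)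
     ×-dec (connected? H ×-dec contains? S H)))

disjoint? : ∀ {n} → Decidable (Disjoint {n})
disjoint? H K = all₂? λ x y → arc? (arcs H) x y →-dec ¬? (arc? (arcs K) x y)

packing? : ∀ {n} {P : Sub n → Set} → U.Decidable P → U.Decidable (Packing P)
packing? {n} {P} P? m =
  map′ (λ { (Hs , g , d) → lookup Hs , g , d }) fromFun
    (anyVec? anySub? m λ Hs → all? (λ i → P? (lookup Hs i))
      ×-dec all₂? (λ i j → ¬? (i ≟ᶠ j) →-dec disjoint? (lookup Hs i) (lookup Hs j)))
  where
  fromFun : Packing P m → ∃ λ (Hs : Vec (Sub n) m) →
    (∀ i → P (lookup Hs i)) × (∀ i j → i ≢ j → Disjoint (lookup Hs i) (lookup Hs j))
  fromFun (H , g , d) = tabulate H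
    , (λ i → subst P (sym (lookup∘tabulate H i)) (g i))
    , (λ i j i≢j → subst₂ Disjoint (sym (lookup∘tabulate H i)) (sym (lookup∘tabulate H j)) (d i j i≢j))

packing-bounded : ∀ {n} {P : Sub n → Set} →
  (∀ H → P H → ∃ λ x → ∃ λ y → x ⟶ y ∈ arcs H) →
  ∀ m → Packing P m → m ≤ n * n
packing-bounded {n} {P} arc m (H , g , d) = injective⇒≤ {f = code} inj
  where
  t h : Fin m → Fin n
  t i = proj₁ (arc (H i) (g i))
  h i = proj₁ (proj₂ (arc (H i) (g i)))
  code : Fin m → Fin (n * n)
  code i = combine (t i) (h i)
  inj : ∀ {i j} → code i ≡ code j → i ≡ j
  inj {i} {j} eq with i ≟ᶠ j
  ... | yes i≡j = i≡j
  ... | no i≢j with combine-injective (t i) (h i) (t j) (h j) eq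
  ...   | tt , hh = contradiction
    (subst₂ (λ x y → x ⟶ y ∈ arcs (H j)) (sym tt) (sym hh) (proj₂ (proj₂ (arc (H j) (g j)))))
    (d i j i≢j (t i) (h i) (proj₂ (proj₂ (arc (H i) (g i)))))

member : ∀ {n} (S : Subset n) → 1 ≤ ∣ S ∣ → Nonempty S
member (true  ∷ S) _ = zero , here
member (false ∷ S) h with member S h
... | x , x∈S = suc x , there x∈S

two-members : ∀ {n} (S : Subset n) → 2 ≤ ∣ S ∣ →
              ∃ λ x → ∃ λ y → x ≢ y × x ∈ S × y ∈ S
two-members (true ∷ S) (s≤s h) with member S h
... | y , y∈S = zero , suc y , (λ ()) , here , there y∈S
two-members (false ∷ S) h with two-members S h
... | x , y , x≢y , x∈S , y∈S =
  suc x , suc y , x≢y ∘ suc-injective , there x∈S , there y∈S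

has-arc : ∀ {n} (S : Subset n) → 2 ≤ ∣ S ∣ → (H : Sub n) →
          Connected H → S ⊆ verts H → ∃ λ x → ∃ λ y → x ⟶ y ∈ arcs H
has-arc S h H c S⊆H with two-members S h
... | x , y , x≢y , x∈S , y∈S with c x y (S⊆H x∈S) (S⊆H y∈S)
...   | ε      = contradiction refl x≢y
...   | e ◅ es = _ , _ , e

subset-of-size : ∀ n k → k ≤ n → ∃ λ (S : Subset n) → ∣ S ∣ ≡ k
subset-of-size n       zero    _       = ⊥ , ∣⊥∣≡0 n
subset-of-size (suc n) (suc k) (s≤s h) with subset-of-size n k h
... | S , eq = true ∷ S , cong suc eq

module _ {n} {P : Subset n → Sub n → Set}
         (P? : ∀ S → U.Decidable (P S))
         (arc : ∀ S → 2 ≤ ∣ S ∣ → ∀ H → P S H → ∃ λ x → ∃ λ y → x ⟶ y ∈ arcs H) where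

  λ-S-exists : ∀ S → 2 ≤ ∣ S ∣ → ∃ (Isλ-S P S)
  λ-S-exists S h = maximum-exists (packing? (P? S))
    ((λ ()) , (λ ()) , λ ()) (n * n) (packing-bounded (arc S h))

  λ-k-exists : ∀ k → 2 ≤ k → k ≤ n → ∃ (Isλ-k P k)
  λ-k-exists k 2≤k k≤n with subset-of-size n k k≤n
  ... | S₀ , refl = minimum-exists value? _ (S₀ , refl , proj₂ (λ-S-exists S₀ 2≤k))
    where
    isλ-S? : ∀ v S → Dec (∣ S ∣ ≡ k × Isλ-S P S v)
    isλ-S? v S with ∣ S ∣ ≟ k
    ... | no ¬eq = no (¬eq ∘ proj₁)
    ... | yes eq with λ-S-exists S (subst (2 ≤_) (sym eq) 2≤k)
    ...   | w , isw = map′ (λ { refl → eq , isw })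
                           (λ { (_ , isv) → isMaximum-unique isw isv }) (w ≟ v)
    value? : ∀ v → Dec (∃ λ S → ∣ S ∣ ≡ k × Isλ-S P S v)
    value? v = anySubset? (isλ-S? v)

abstract
  λᵍ-exists : ∀ {n} (G : Graph n) k → 2 ≤ k → k ≤ n → ∃ (Isλ-k (IsSTree G) k)
  λᵍ-exists G = λ-k-exists (isSTree? G)
    λ S h H t → has-arc S h H (IsSTree.connected t) (IsSTree.contains t)

  λᵈ-exists : ∀ {n} (D : Digraph n) k → 2 ≤ k → k ≤ n → ∃ (Isλ-k (IsStrongSubgraph D) k)
  λᵈ-exists D = λ-k-exists (isStrongSubgraph? D)
    λ S h H t → has-arc S h H (IsStrongSubgraph.strong t) (IsStrongSubgraph.contains t)

λᵍ : ∀ {n} → Graph n → (k : ℕ) → 2 ≤ k → k ≤ n → ℕ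
λᵍ G k 2≤k k≤n = proj₁ (λᵍ-exists G k 2≤k k≤n)

λᵈ : ∀ {n} → Digraph n → (k : ℕ) → 2 ≤ k → k ≤ n → ℕ
λᵈ D k 2≤k k≤n = proj₁ (λᵈ-exists D k 2≤k k≤n)

λᵍ-spec : ∀ {n} (G : Graph n) k 2≤k k≤n → Isλ-k (IsSTree G) k (λᵍ G k 2≤k k≤n)
λᵍ-spec G k 2≤k k≤n = proj₂ (λᵍ-exists G k 2≤k k≤n)

λᵈ-spec : ∀ {n} (D : Digraph n) k 2≤k k≤n → Isλ-k (IsStrongSubgraph D) k (λᵈ D k 2≤k k≤n)
λᵈ-spec D k 2≤k k≤n = proj₂ (λᵈ-exists D k 2≤k k≤n)

{-# OPTIONS --safe #-}

-- An S-tree, read as a symmetric digraph, is a strong subgraph, so a packing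
-- of S-trees is a packing of strong subgraphs; the star K_{1,n-1} attains
-- equality, since a leaf has out-degree one.
-- For S = {x , y}, arc-disjoint strong subgraphs yield arc-disjoint paths from
-- x to y, i.e. a flow of value m.  Cancelling pairs of opposite arcs keeps
-- the value and makes the flow use every edge at most once; following unused
-- arcs from x then peels off m edge-disjoint trails to y, each of which
-- contains a simple path, which is an S-tree.
module Submission where

open import Defs
open import Data.Bool using (true; false)
open import Data.Fin using (Fin; zero; suc)
open import Data.Fin.Properties using () renaming (_≟_ to _≟ᶠ_; suc-injective to suc-injᶠ)
open import Data.Fin.Subset using (Subset; _∈_; ∣_∣)
open import Data.List using (List; []; _∷_; _++_; _∷ʳ_; length; map; replicate)
open import Data.List.Membership.Propositional using () renaming (_∈_ to _∈ₗ_; _∉_ to _∉ₗ_)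
open import Data.List.Membership.Propositional.Properties using (∈-∃++; ∈-map⁺; ∈-map⁻; ∈-++⁺ˡ; ∈-++⁺ʳ; ∈-++⁻)
import Data.List.Membership.DecPropositional as DecMembership
open import Data.List.Relation.Binary.Permutation.Propositional using (_↭_; refl; prep; swap; ↭-refl; ↭-sym; ↭-trans; ↭⇒↭ₛ)
open import Data.List.Relation.Binary.Permutation.Propositional.Properties using (map⁺; ++⁺ˡ; ++⁺ʳ; shift; drop-∷; ∈-resp-↭; ↭-length)
import Data.List.Relation.Binary.Permutation.Setoid.Properties as Permₛ
open import Data.List.Relation.Unary.All as All using ([]; _∷_)
open import Data.List.Relation.Unary.AllPairs using (AllPairs; []; _∷_)
open import Data.List.Relation.Unary.Any using (here; there)
open import Data.List.Relation.Unary.Linked using (Linked; _∷_)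
open import Data.List.Relation.Unary.Unique.Propositional using (Unique)
open import Data.List.Relation.Unary.Unique.Propositional.Properties using () renaming (++⁺ to Unique-++⁺)
open import Data.Nat using (ℕ; zero; suc; _≤_; _<_; _≥_; z≤n; s≤s)
open import Data.Nat.Properties using (≤-refl; ≤-trans; ≤-antisym; <-trans; <-irrefl; m≤n⇒m≤1+n; suc-injective)
open import Data.Product as Product using (∃; _×_; _,_; proj₁; proj₂)
open import Data.Product.Properties using (≡-dec)
open import Data.Sum as Sum using (_⊎_; inj₁; inj₂)
open import Data.Vec using (tabulate; []; _∷_; here; there)
open import Data.Vec.Properties using (lookup∘tabulate; lookup⇒[]=; []=⇒lookup)
open import Function using (_∘_; id)
open import Level using (0ℓ)
open import Relation.Binary.Core using (Rel)
open import Relation.Binary.Construct.Closure.ReflexiveTransitive as Star using (Star; ε; _◅_; _◅◅_)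
import Relation.Binary.Definitions as B
open import Relation.Binary.PropositionalEquality using (_≡_; _≢_; refl; sym; trans; cong; subst; resp₂; setoid)
open import Relation.Nullary using (¬_; yes; no; does; contradiction)
open import Relation.Nullary.Decidable using (dec-true; _⊎-dec_; _×-dec_; ¬?)
import Relation.Unary as U

private variable
  n m : ℕ

-- Subsets and arc sets given by decidable predicates

comprehension : {P : Fin n → Set} → U.Decidable P → Subset n
comprehension P? = tabulate (does ∘ P?)

module _ {P : Fin n → Set} (P? : U.Decidable P) where

  ∈-comprehension⁺ : ∀ {x} → P x → x ∈ comprehension P?
  ∈-comprehension⁺ {x} px =
    lookup⇒[]= x _ (trans (lookup∘tabulate (does ∘ P?) x) (dec-true (P? x) px))

  ∈-comprehension⁻ : ∀ {x} → x ∈ comprehension P? → P x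
  ∈-comprehension⁻ {x} x∈
    with P? x | trans (sym (lookup∘tabulate (does ∘ P?) x)) ([]=⇒lookup x∈)
  ... | yes px | _ = px

arcsOf : {R : Rel (Fin n) 0ℓ} → B.Decidable R → Arcs n
arcsOf R? = tabulate λ x → comprehension (R? x)

module _ {R : Rel (Fin n) 0ℓ} (R? : B.Decidable R) where

  arcsOf⁺ : ∀ {x y} → R x y → x ⟶ y ∈ arcsOf R?
  arcsOf⁺ {x} {y} r =
    subst (y ∈_) (sym (lookup∘tabulate _ x)) (∈-comprehension⁺ (R? x) r)

  arcsOf⁻ : ∀ {x y} → x ⟶ y ∈ arcsOf R? → R x y
  arcsOf⁻ {x} {y} e =
    ∈-comprehension⁻ (R? x) (subst (y ∈_) (lookup∘tabulate _ x) e)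

-- Comparing generalized connectivities

-- At a set of size `k` that is minimizing for `Q`, a largest `P`-packing has at least `a` members
-- because `a` is the minimum for `P`; transferred to `Q`, it has at most `b`.
λ-k-mono : (P Q : Subset n → Sub n → Set) {k a b : ℕ} →
           (∀ S → ∣ S ∣ ≡ k → ∃ (Isλ-S P S)) →
           (∀ S → ∣ S ∣ ≡ k → ∀ {m} → Packing (P S) m → Packing (Q S) m) →
           Isλ-k P k a → Isλ-k Q k b → a ≤ b
λ-k-mono P Q λP-exists P⇒Q (_ , a-least) ((S , ∣S∣≡k , _ , b-greatest) , _)
  with λP-exists S ∣S∣≡k
... | c , packing , c-greatest =
  ≤-trans (a-least c (S , ∣S∣≡k , packing , c-greatest))
          (b-greatest c (P⇒Q S ∣S∣≡k packing))

module _ {k : ℕ} (2≤k : 2 ≤ k) where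

  λ-S-tree-exists : (G : Graph n) → ∀ S → ∣ S ∣ ≡ k → ∃ (Isλ-S (IsSTree G) S)
  λ-S-tree-exists G S refl = λ-S-exists (isSTree? G)
    (λ S h H t → has-arc S h H (IsSTree.connected t) (IsSTree.contains t)) S 2≤k

  λ-S-strong-exists : (D : Digraph n) → ∀ S → ∣ S ∣ ≡ k → ∃ (Isλ-S (IsStrongSubgraph D) S)
  λ-S-strong-exists D S refl = λ-S-exists (isStrongSubgraph? D)
    (λ S h H t → has-arc S h H (IsStrongSubgraph.strong t) (IsStrongSubgraph.contains t)) S 2≤k

STree⇒strong : (G : Graph n) {S : Subset n} {H : Sub n} →
               IsSTree G S H → IsStrongSubgraph (symmetricDigraph G) S H
STree⇒strong G (isSTree subgraph _ nonempty connected _ contains) =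
  isStrong subgraph nonempty connected contains

λᵍ≤λᵈ : (G : Graph n) → ∀ k 2≤k k≤n → λᵍ G k 2≤k k≤n ≤ λᵈ (symmetricDigraph G) k 2≤k k≤n
λᵍ≤λᵈ G k 2≤k k≤n = λ-k-mono (IsSTree G) (IsStrongSubgraph (symmetricDigraph G))
  (λ-S-tree-exists 2≤k G)
  (λ _ _ (H , trees , disjoint) → H , STree⇒strong G ∘ trees , disjoint)
  (λᵍ-spec G k 2≤k k≤n) (λᵈ-spec (symmetricDigraph G) k 2≤k k≤n)

-- Rooted trees

-- Common interface for stars and paths: `functional` and `decreasing` rule out cycles, and
-- `to-root` gives connectedness.
record RootedTree (n : ℕ) : Set₁ where
  field
    Vertex      : Fin n → Set
    vertex?     : U.Decidable Vertex
    Parent      : Rel (Fin n) 0ℓ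
    parent?     : B.Decidable Parent
    root        : Fin n
    root-vertex : Vertex root
    ends        : ∀ {x y} → Parent x y → Vertex x × Vertex y
    functional  : ∀ {x y z} → Parent x y → Parent x z → y ≡ z
    rank        : Fin n → ℕ
    decreasing  : ∀ {x y} → Parent x y → rank y < rank x
    to-root     : ∀ {x} → Vertex x → Star Parent x root

  Edge : Rel (Fin n) 0ℓ
  Edge x y = Parent x y ⊎ Parent y x

  edge? : B.Decidable Edge
  edge? x y = parent? x y ⊎-dec parent? y x

  asSub : Sub n
  asSub = sub (comprehension vertex?) (arcsOf edge?)

  private
    arc⇒edge : ∀ {x y} → x ⟶ y ∈ arcs asSub → Edge x y
    arc⇒edge = arcsOf⁻ edge?

    edge⇒arc : ∀ {x y} → Edge x y → x ⟶ y ∈ arcs asSub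
    edge⇒arc = arcsOf⁺ edge?

    edge-ends : ∀ {x y} → Edge x y → Vertex x × Vertex y
    edge-ends (inj₁ p) = ends p
    edge-ends (inj₂ p) = Product.swap (ends p)

    connected : Connected asSub
    connected x y x∈ y∈ =
      Star.map (edge⇒arc ∘ inj₁) (to-root (∈-comprehension⁻ vertex? x∈))
      ◅◅ Star.reverse (edge⇒arc ∘ inj₂) (to-root (∈-comprehension⁻ vertex? y∈))

    -- What remains of a cycle based at `x` once the walk has reached `b`.
    Closing : Fin n → Fin n → List (Fin n) → Set
    Closing x b ws = Linked (Arc (arcs asSub)) (b ∷ ws ∷ʳ x)

    -- A walk without backtracking that has once moved away from the root
    -- keeps doing so.
    ascend : ∀ {x a b} ws → Parent b a → Unique (x ∷ a ∷ b ∷ ws) → Closing x b ws →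
             (∃ λ z → z ∈ₗ b ∷ ws × Parent x z) × rank b < rank x
    ascend [] ba ((x≢a ∷ _) ∷ _) (e ∷ _) with arc⇒edge e
    ... | inj₁ bx = contradiction (functional bx ba) x≢a
    ... | inj₂ xb = (_ , here refl , xb) , decreasing xb
    ascend (c ∷ ws) ba ((_ ∷ x#) ∷ (_ ∷ a≢c ∷ _) ∷ u) (e ∷ es) with arc⇒edge e
    ... | inj₁ bc = contradiction (functional ba bc) a≢c
    ... | inj₂ cb with ascend ws cb (x# ∷ u) es
    ...   | (z , z∈ , xz) , c<x = (z , there z∈ , xz) , <-trans (decreasing cb) c<x

    -- As long as the walk moves towards the root, ranks fall. Either it does so until it closes,
    -- and `x` lies below `b` in rank, or it turns once and `ascend` shows that it enters `x` from a
    -- parent of `x`.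
    descend : ∀ {x b} ws → Unique (x ∷ b ∷ ws) → Closing x b ws →
              (∃ λ z → z ∈ₗ b ∷ ws × Parent x z) ⊎ rank x < rank b
    descend [] _ (e ∷ _) with arc⇒edge e
    ... | inj₁ bx = inj₂ (decreasing bx)
    ... | inj₂ xb = inj₁ (_ , here refl , xb)
    descend (c ∷ ws) u@((_ ∷ x#) ∷ (_ ∷ u′)) (e ∷ es) with arc⇒edge e
    ... | inj₁ bc = Sum.map (λ (z , z∈ , xz) → z , there z∈ , xz)
                            (λ x<c → <-trans x<c (decreasing bc))
                            (descend ws (x# ∷ u′) es)
    ... | inj₂ cb with ascend ws cb u es
    ...   | (z , z∈ , xz) , _ = inj₁ (z , there z∈ , xz)

    -- The first two steps decide. If `y` is a child of `x`, the second step cannot go to another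
    -- parent of `y`, so ranks rise all the way round. If `y` is the parent of `x`, the cycle either
    -- returns through a parent of `x` other than `y` or falls in rank all the way round.
    acyclic : ¬ Cycle asSub
    acyclic (x , y ∷ [] , s≤s () , _)
    acyclic (x , y ∷ w ∷ ws , _ , u@((_ ∷ x#@(x≢w ∷ _)) ∷ y# ∷ u′) , e ∷ e′ ∷ es)
      with arc⇒edge e | arc⇒edge e′
    ... | inj₂ yx | inj₁ yw = contradiction (functional yx yw) x≢w
    ... | inj₂ yx | inj₂ wy = <-irrefl refl
      (<-trans (decreasing yx) (<-trans (decreasing wy) (proj₂ (ascend ws wy u es))))
    ... | inj₁ xy | inj₂ wy with ascend ws wy u es
    ...   | (z , z∈ , xz) , _ = All.lookup y# z∈ (functional xy xz)
    acyclic (x , y ∷ w ∷ ws , _ , (_ ∷ x#) ∷ y# ∷ u′ , e ∷ e′ ∷ es)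
        | inj₁ xy | inj₁ yw with descend ws (x# ∷ u′) es
    ...   | inj₁ (z , z∈ , xz) = All.lookup y# z∈ (functional xy xz)
    ...   | inj₂ x<w = <-irrefl refl
      (<-trans x<w (<-trans (decreasing yw) (decreasing xy)))

  rootedTree-isSTree : (G : Graph n) {S : Subset n} →
    (∀ {x y} → Parent x y → x ⟶ y ∈ Graph.edges G) → (∀ {x} → x ∈ S → Vertex x) →
    IsSTree G S asSub
  rootedTree-isSTree G {S} parent⊆G S⊆V = record
    { subgraph   = isSubgraph
        (λ x y → Sum.[ parent⊆G , Graph.symmetric G y x ∘ parent⊆G ] ∘ arc⇒edge)
        (λ x y e → Product.map (∈-comprehension⁺ vertex?) (∈-comprehension⁺ vertex?)
                     (edge-ends (arc⇒edge e)))
    ; undirected = λ x y → edge⇒arc ∘ Sum.swap ∘ arc⇒edge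
    ; nonempty   = root , ∈-comprehension⁺ vertex? root-vertex
    ; connected  = connected
    ; acyclic    = acyclic
    ; contains   = ∈-comprehension⁺ vertex? ∘ S⊆V
    }

-- Stars

module _ (n : ℕ) where

  starTree : RootedTree (suc n)
  starTree = record
    { Vertex      = U.U
    ; vertex?     = λ _ → yes _
    ; Parent      = λ x y → x ≢ zero × y ≡ zero
    ; parent?     = λ x y → ¬? (x ≟ᶠ zero) ×-dec (y ≟ᶠ zero)
    ; root        = zero
    ; root-vertex = _
    ; ends        = λ _ → _ , _
    ; functional  = λ { (_ , refl) (_ , refl) → refl }
    ; rank        = λ { zero → 0 ; (suc _) → 1 }
    ; decreasing  = λ { {zero} (0≢0 , _) → contradiction refl 0≢0
                      ; {suc _} (_ , refl) → s≤s z≤n }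
    ; to-root     = λ { {zero} _ → ε ; {suc _} _ → ((λ ()) , refl) ◅ ε }
    }

  open RootedTree starTree using (Edge; edge?; asSub; rootedTree-isSTree)

  starGraph : Graph (suc n)
  starGraph = record
    { edges     = arcsOf edge?
    ; symmetric = λ x y → arcsOf⁺ edge? ∘ Sum.swap ∘ arcsOf⁻ edge?
    ; loopless  = λ x e → no-loop (arcsOf⁻ edge? e)
    }
    where
    no-loop : ∀ {x} → ¬ Edge x x
    no-loop (inj₁ (x≢0 , x≡0)) = x≢0 x≡0
    no-loop (inj₂ (x≢0 , x≡0)) = x≢0 x≡0

  -- The star is itself a spanning tree, so the same tree serves every `S`.
  starPacking : ∀ S → Packing (IsSTree starGraph S) 1
  starPacking S = (λ _ → asSub)
    , (λ _ → rootedTree-isSTree starGraph (arcsOf⁺ edge? ∘ inj₁) _)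
    , λ { zero zero 0≢0 → contradiction refl 0≢0 }

  -- At most one of two distinct members is the centre; the pair is ordered so that a leaf comes
  -- first.
  leaf-of : ∀ (S : Subset (suc n)) → 2 ≤ ∣ S ∣ →
            ∃ λ x → ∃ λ y → x ≢ zero × x ≢ y × x ∈ S × y ∈ S
  leaf-of S 2≤S with two-members S 2≤S
  ... | suc x , y , x≢y , x∈ , y∈ = suc x , y , (λ ()) , x≢y , x∈ , y∈
  ... | zero , y , x≢y , x∈ , y∈  = y , zero , x≢y ∘ sym , x≢y ∘ sym , y∈ , x∈

  -- Each strong subgraph contains a walk from the leaf `x` to `y`, whose first arc must go to the
  -- centre. Two members of a packing would share that arc.
  star-strong-packing≤1 : ∀ S → 2 ≤ ∣ S ∣ → ∀ {m} →
    Packing (IsStrongSubgraph (symmetricDigraph starGraph) S) m → m ≤ 1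
  star-strong-packing≤1 S 2≤S {zero} _ = z≤n
  star-strong-packing≤1 S 2≤S {suc zero} _ = s≤s z≤n
  star-strong-packing≤1 S 2≤S {suc (suc m)} (H , strong , disjoint)
    with leaf-of S 2≤S
  ... | x , y , x≢0 , x≢y , x∈S , y∈S =
    contradiction (leaf-arc (suc zero)) (disjoint zero (suc zero) (λ ()) x zero (leaf-arc zero))
    where
    leaf-arc : ∀ i → x ⟶ zero ∈ arcs (H i)
    leaf-arc i with strong i
    ... | isStrong subgraph _ connected contains
      with connected x y (contains x∈S) (contains y∈S)
    ... | ε = contradiction refl x≢y
    ... | e ◅ _ with arcsOf⁻ edge? (_IsSubgraphOf_.arcs⊆ subgraph _ _ e)
    ...   | inj₁ (_ , refl) = e
    ...   | inj₂ (_ , x≡0)  = contradiction x≡0 x≢0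

  module _ (k : ℕ) (2≤k : 2 ≤ k) (k≤n : k ≤ suc n) where

    -- Positivity keeps sharpness from being trivial: an edgeless graph gives the equality 0 = 0.
    1≤λᵍ-star : 1 ≤ λᵍ starGraph k 2≤k k≤n
    1≤λᵍ-star with λᵍ-spec starGraph k 2≤k k≤n
    ... | (S , _ , _ , greatest) , _ = greatest 1 (starPacking S)

    λᵈ-star≤1 : λᵈ (symmetricDigraph starGraph) k 2≤k k≤n ≤ 1
    λᵈ-star≤1 with λᵈ-spec (symmetricDigraph starGraph) k 2≤k k≤n
    ... | (S , refl , packing , _) , _ = star-strong-packing≤1 S 2≤k packing

    λᵈ-star≡λᵍ-star : λᵈ (symmetricDigraph starGraph) k 2≤k k≤n ≡ λᵍ starGraph k 2≤k k≤n
    λᵈ-star≡λᵍ-star =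
      ≤-antisym (≤-trans λᵈ-star≤1 1≤λᵍ-star) (λᵍ≤λᵈ starGraph k 2≤k k≤n)

-- Simple paths

tails heads : List (Fin n × Fin n) → List (Fin n)
tails = map proj₁
heads = map proj₂

Joined : List (Fin n × Fin n) → Rel (Fin n) 0ℓ
Joined L x y = (x , y) ∈ₗ L

∈-tails : ∀ {x} {z : Fin n} {L} → (x , z) ∈ₗ L → x ∈ₗ tails L
∈-tails = ∈-map⁺ proj₁

-- The vertices of a path to y are y and the tails of its arcs.
data SimplePath (R : Rel (Fin n) 0ℓ) (y : Fin n) : Fin n → List (Fin n × Fin n) → Set where
  stop : SimplePath R y y []
  step : ∀ {x z L} → R x z → x ∉ₗ y ∷ tails L → SimplePath R y z L →
         SimplePath R y x ((x , z) ∷ L)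

module _ {n} {R : Rel (Fin n) 0ℓ} {y : Fin n} where

  suffix : ∀ {x v L} → SimplePath R y x L → v ∈ₗ y ∷ tails L → ∃ (SimplePath R y v)
  suffix p (here refl) = _ , stop
  suffix p@(step _ _ _) (there (here refl)) = _ , p
  suffix (step _ _ p) (there (there v∈)) = suffix p (there v∈)

  -- If `x` already lies on the path built from its successor, the part of that path from `x` on is
  -- taken instead, which cuts out the loop through `x`.
  erase-loops : ∀ {x} → Star R x y → ∃ (SimplePath R y x)
  erase-loops ε = _ , stop
  erase-loops {x} (r ◅ rs) with erase-loops rs
  ... | L , p with DecMembership._∈?_ _≟ᶠ_ x (y ∷ tails L)
  ...   | yes x∈ = suffix p x∈
  ...   | no x∉  = _ , step r x∉ p

  path⊆ : ∀ {x a b L} → SimplePath R y x L → (a , b) ∈ₗ L → R a b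
  path⊆ (step r _ _) (here refl) = r
  path⊆ (step _ _ p) (there ab∈) = path⊆ p ab∈

  -- A repeated arc would repeat its tail.
  path-unique : ∀ {x L} → SimplePath R y x L → Unique L
  path-unique stop = []
  path-unique (step _ x∉ p) =
    All.tabulate (λ { {a , b} ab∈ refl → x∉ (there (∈-tails ab∈)) }) ∷ path-unique p

  start-vertex : ∀ {x L} → SimplePath R y x L → x ∈ₗ y ∷ tails L
  start-vertex stop         = here refl
  start-vertex (step _ _ _) = there (here refl)

  -- The head of an arc is the tail of the next arc, or `y` after the last one.
  head-vertex : ∀ {x a b L} → SimplePath R y x L → (a , b) ∈ₗ L → b ∈ₗ y ∷ tails L
  head-vertex (step _ _ p) e = weaken (go p e)
    where
    weaken : ∀ {v u : Fin n} {vs} → v ∈ₗ u ∷ vs → ∀ {w} → v ∈ₗ u ∷ w ∷ vs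
    weaken (here eq)  = here eq
    weaken (there v∈) = there (there v∈)
    go : ∀ {x z a b L} → SimplePath R y z L → (a , b) ∈ₗ (x , z) ∷ L → b ∈ₗ y ∷ tails L
    go p (here refl) = start-vertex p
    go p (there e)   = head-vertex p e

  path-functional : ∀ {x a b c L} → SimplePath R y x L →
                    (a , b) ∈ₗ L → (a , c) ∈ₗ L → b ≡ c
  path-functional (step _ _ _) (here refl) (here refl) = refl
  path-functional (step _ x∉ _) (here refl) (there e) = contradiction (there (∈-tails e)) x∉
  path-functional (step _ x∉ _) (there e) (here refl) = contradiction (there (∈-tails e)) x∉
  path-functional (step _ _ p) (there e) (there e′) = path-functional p e e′

  path-to-end : ∀ {x v L} → SimplePath R y x L → v ∈ₗ y ∷ tails L → Star (Joined L) v y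
  path-to-end _ (here refl) = ε
  path-to-end (step _ _ p) (there (here refl)) =
    here refl ◅ Star.map there (path-to-end p (start-vertex p))
  path-to-end (step _ _ p) (there (there v∈)) = Star.map there (path-to-end p (there v∈))

-- On a simple path this counts the arcs from `v` to the end. The default 0 is the right value at
-- the end, which is the tail of no arc.
distance : List (Fin n × Fin n) → Fin n → ℕ
distance [] v = 0
distance ((x , _) ∷ L) v with v ≟ᶠ x
... | yes _ = suc (length L)
... | no _  = distance L v

distance≤length : ∀ L (v : Fin n) → distance L v ≤ length L
distance≤length [] v = z≤n
distance≤length ((x , _) ∷ L) v with v ≟ᶠ x
... | yes _ = ≤-refl
... | no _  = m≤n⇒m≤1+n (distance≤length L v)

-- No head equals the start `x`, so `b` is looked up in the rest of the path. There its distance is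
-- at most the length of the rest, which settles the first arc; later arcs follow by induction.
distance-decreasing : ∀ {R : Rel (Fin n) 0ℓ} {x y a b L} → SimplePath R y x L →
                      (a , b) ∈ₗ L → distance L b < distance L a
distance-decreasing {x = x} {a = a} {b = b} (step {L = L} _ x∉ p) e with b ≟ᶠ x | a ≟ᶠ x | e
... | yes refl | _ | here refl = contradiction (start-vertex p) x∉
... | yes refl | _ | there e′ = contradiction (head-vertex p e′) x∉
... | no _ | yes _ | _ = s≤s (distance≤length L b)
... | no _ | no a≢x | here refl = contradiction refl a≢x
... | no _ | no _ | there e′ = distance-decreasing p e′

pathTree : ∀ {R : Rel (Fin n) 0ℓ} {x y L} → SimplePath R y x L → RootedTree n
pathTree {n} {x = x} {y} {L} p = record
  { Vertex      = _∈ₗ y ∷ tails L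
  ; vertex?     = λ v → DecMembership._∈?_ _≟ᶠ_ v (y ∷ tails L)
  ; Parent      = Joined L
  ; parent?     = λ a b → DecMembership._∈?_ (≡-dec _≟ᶠ_ _≟ᶠ_) (a , b) L
  ; root        = y
  ; root-vertex = here refl
  ; ends        = λ e → there (∈-tails e) , head-vertex p e
  ; functional  = path-functional p
  ; rank        = distance L
  ; decreasing  = distance-decreasing p
  ; to-root     = path-to-end p
  }

-- Flows

-- L lists the arcs of an integral flow whose sources and sinks, with
-- multiplicity, are the lists C and B.
Balanced : List (Fin n × Fin n) → (B C : List (Fin n)) → Set
Balanced L B C = tails L ++ B ↭ heads L ++ C

module _ {n} {B C : List (Fin n)} where

  balanced-↭ : ∀ {L L′} → L ↭ L′ → Balanced L B C → Balanced L′ B C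
  balanced-↭ L↭L′ bal = ↭-trans (++⁺ʳ B (↭-sym (map⁺ proj₁ L↭L′)))
    (↭-trans bal (++⁺ʳ C (map⁺ proj₂ L↭L′)))

  -- An arc x z of the flow is a unit sink at x together with a unit source
  -- at z, and conversely.
  balanced-detach : ∀ {x z} L → Balanced ((x , z) ∷ L) B C → Balanced L (x ∷ B) (z ∷ C)
  balanced-detach {x} {z} L bal =
    ↭-trans (shift x (tails L) B) (↭-trans bal (↭-sym (shift z (heads L) C)))

  balanced-attach : ∀ {x z} L → Balanced L (x ∷ B) (z ∷ C) → Balanced ((x , z) ∷ L) B C
  balanced-attach {x} {z} L bal =
    ↭-trans (↭-sym (shift x (tails L) B)) (↭-trans bal (shift z (heads L) C))

  balanced-drop : ∀ {x} L → Balanced L (x ∷ B) (x ∷ C) → Balanced L B C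
  balanced-drop {x} L bal = drop-∷
    (↭-trans (↭-sym (shift x (tails L) B)) (↭-trans bal (shift x (heads L) C)))

balanced-ends : ∀ {B B′ C C′} (L : List (Fin n × Fin n)) → B ↭ B′ → C ↭ C′ →
                Balanced L B C → Balanced L B′ C′
balanced-ends L B↭B′ C↭C′ bal = ↭-trans (++⁺ˡ (tails L) (↭-sym B↭B′))
  (↭-trans bal (++⁺ˡ (heads L) C↭C′))

path-balanced : ∀ {R : Rel (Fin n) 0ℓ} {x y L} K {B C} → SimplePath R y x L →
                Balanced K B C → Balanced (L ++ K) (y ∷ B) (x ∷ C)
path-balanced {y = y} K {B} {C} stop bal =
  ↭-trans (shift y (tails K) B) (↭-trans (prep y bal) (↭-sym (shift y (heads K) C)))
path-balanced K (step {x} {z} {L} _ _ p) bal =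
  -- The rest of the path carries a unit from `z` to `y`. Adding `x` as both a sink and a source,
  -- with `z` moved to the front of the sources, gives exactly the ends needed to attach the arc
  -- from `x` to `z`.
  balanced-attach (L ++ K)
    (↭-trans (shift x (tails (L ++ K)) _)
      (↭-trans (prep x (path-balanced K p bal))
        (↭-trans (↭-sym (shift x (heads (L ++ K)) _))
          (++⁺ˡ (heads (L ++ K)) (swap x z ↭-refl)))))

∈⇒↭∷ : ∀ {A : Set} {x : A} {xs} → x ∈ₗ xs → ∃ λ ys → xs ↭ x ∷ ys
∈⇒↭∷ {x = x} x∈ with ∈-∃++ x∈
... | ys , zs , refl = ys ++ zs , shift x ys zs

-- One walk per subgraph is made simple, so that no arc repeats within it; arc-disjointness excludes
-- repetitions between different walks. Together the paths form a flow of value `m`.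
flow-of-packing : ∀ {x y : Fin n} m (H : Fin m → Sub n) →
  (∀ i → Star (Arc (arcs (H i))) x y) → (∀ i j → i ≢ j → Disjoint (H i) (H j)) →
  ∃ λ L → Unique L × (∀ {a b} → (a , b) ∈ₗ L → ∃ λ i → a ⟶ b ∈ arcs (H i))
        × Balanced L (replicate m y) (replicate m x)
flow-of-packing zero H walks disjoint = [] , [] , (λ ()) , refl
flow-of-packing (suc m) H walks disjoint
  with erase-loops (walks zero)
     | flow-of-packing m (H ∘ suc) (walks ∘ suc)
         (λ i j i≢j → disjoint (suc i) (suc j) (i≢j ∘ suc-injᶠ))
... | K , p | L , unique , L⊆ , bal =
  K ++ L , Unique-++⁺ (path-unique p) unique K#L , K++L⊆ , path-balanced L p bal
  where
  K#L : ∀ {e} → ¬ (e ∈ₗ K × e ∈ₗ L)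
  K#L (∈K , ∈L) with L⊆ ∈L
  ... | i , arc = disjoint zero (suc i) (λ ()) _ _ (path⊆ p ∈K) arc
  K++L⊆ : ∀ {a b} → (a , b) ∈ₗ K ++ L → ∃ λ i → a ⟶ b ∈ arcs (H i)
  K++L⊆ e with ∈-++⁻ K e
  ... | inj₁ ∈K = zero , path⊆ p ∈K
  ... | inj₂ ∈L = Product.map suc id (L⊆ ∈L)

-- Flows that use each edge at most once

DistinctEdges : Rel (Fin n × Fin n) 0ℓ
DistinctEdges e f = e ≢ f × e ≢ Product.swap f

distinctEdges-sym : B.Symmetric (DistinctEdges {n})
distinctEdges-sym (e≢f , e≢f̄) = e≢f ∘ sym , λ { refl → e≢f̄ refl }

allDistinct-↭ : {L L′ : List (Fin n × Fin n)} → L ↭ L′ →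
                AllPairs DistinctEdges L → AllPairs DistinctEdges L′
allDistinct-↭ L↭L′ = Permₛ.AllPairs-resp-↭ (setoid _) distinctEdges-sym
  (resp₂ DistinctEdges) (↭⇒↭ₛ L↭L′)

-- Two opposite arcs contribute the same vertices to the tails as to the heads, so deleting both
-- keeps the balance. Preservation is stated for all ends `B` and `C` because the recursion applies
-- it after the first arc has been detached, which changes the ends.
cancel-opposite : (L : List (Fin n × Fin n)) → Unique L →
  ∃ λ L′ → AllPairs DistinctEdges L′ × (∀ {e} → e ∈ₗ L′ → e ∈ₗ L)
         × (∀ {B C} → Balanced L B C → Balanced L′ B C)
cancel-opposite [] _ = [] , [] , id , id
cancel-opposite ((a , b) ∷ L) (ab# ∷ unique) with cancel-opposite L unique
... | L′ , distinct , L′⊆L , bal with DecMembership._∈?_ (≡-dec _≟ᶠ_ _≟ᶠ_) (b , a) L′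
...   | no ba∉ = (a , b) ∷ L′
  -- The new arc differs from the kept arcs because the original list has no repetition, and from
  -- their reverses because `(b , a)` is not among them.
  , All.tabulate (λ e∈ → All.lookup ab# (L′⊆L e∈) , λ { refl → ba∉ e∈ }) ∷ distinct
  , (λ { (here eq) → here eq ; (there e∈) → there (L′⊆L e∈) })
  , λ bal₀ → balanced-attach L′ (bal (balanced-detach L bal₀))
...   | yes ba∈ with ∈⇒↭∷ ba∈
...     | L″ , L′↭ with allDistinct-↭ L′↭ distinct
...       | _ ∷ distinct″ = L″ , distinct″
  , (λ e∈ → there (L′⊆L (∈-resp-↭ (↭-sym L′↭) (there e∈))))
  -- Detaching both arcs adds the sinks `b`, `a` and the sources `a`, `b`, which cancel in pairs.
  , λ bal₀ → balanced-drop L″ (balanced-drop L″ (balanced-ends L″ ↭-refl (swap a b ↭-refl)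
      (balanced-detach L″ (balanced-↭ L′↭ (bal (balanced-detach L bal₀))))))

-- At a source other than y more arcs leave than enter, so the trail can
-- always be continued until it reaches y.
peel-trail : ∀ {y : Fin n} m {C} l c L → length L ≡ l →
  Balanced L (replicate (suc m) y) (c ∷ C) →
  ∃ λ T → ∃ λ L′ → L ↭ T ++ L′ × Star (Joined T) c y × Balanced L′ (replicate m y) C
peel-trail {y = y} m {C} l c L ∣L∣ bal with c ≟ᶠ y
-- The source already sits at `y`: the empty trail suffices, and this source cancels one of the
-- sinks.
... | yes refl = [] , L , ↭-refl , ε , balanced-drop L bal
-- As a source, `c` occurs on the right of the balance, hence on the left; the sinks there are all
-- `y`, so `c` is the tail of some arc.
... | no c≢y = continue l ∣L∣ (leaving (∈-resp-↭ (↭-sym bal) (∈-++⁺ʳ (heads L) (here refl))))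
  where
  replicate-≡ : ∀ {v} k → v ∈ₗ replicate k y → v ≡ y
  replicate-≡ (suc k) (here eq)  = eq
  replicate-≡ (suc k) (there v∈) = replicate-≡ k v∈
  leaving : c ∈ₗ tails L ++ replicate (suc m) y → ∃ λ d → (c , d) ∈ₗ L
  leaving c∈ with ∈-++⁻ (tails L) c∈
  ... | inj₂ c∈y = contradiction (replicate-≡ (suc m) c∈y) c≢y
  ... | inj₁ c∈L with ∈-map⁻ proj₁ c∈L
  ...   | (_ , d) , cd∈ , refl = d , cd∈
  -- The length `l` drives the recursion, since the list left after removing an arc is known only up
  -- to permutation.
  continue : ∀ l → length L ≡ l → (∃ λ d → (c , d) ∈ₗ L) →
    ∃ λ T → ∃ λ L′ → L ↭ T ++ L′ × Star (Joined T) c y × Balanced L′ (replicate m y) C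
  continue l ∣L∣ (d , cd∈) with ∈⇒↭∷ cd∈
  continue zero ∣L∣ _ | L₁ , L↭ = contradiction (trans (sym ∣L∣) (↭-length L↭)) λ ()
  continue (suc l) ∣L∣ (d , cd∈) | L₁ , L↭
    -- Detaching the chosen arc makes `c` a sink as well as a source; these cancel, so the unit
    -- source has moved from `c` to `d`.
    with peel-trail m l d L₁ (suc-injective (trans (sym (↭-length L↭)) ∣L∣))
           (balanced-drop L₁ (balanced-ends L₁ ↭-refl (swap d c ↭-refl)
             (balanced-detach L₁ (balanced-↭ L↭ bal))))
  ... | T , L′ , L₁↭ , walk , bal′ =
    (c , d) ∷ T , L′ , ↭-trans L↭ (prep _ L₁↭) , here refl ◅ Star.map there walk , bal′

-- Decomposition of a flow into edge-disjoint trails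

EdgeDisjoint : (T T′ : List (Fin n × Fin n)) → Set
EdgeDisjoint T T′ = ∀ {e f} → e ∈ₗ T → f ∈ₗ T′ → DistinctEdges e f

edgeDisjoint-sym : {T T′ : List (Fin n × Fin n)} → EdgeDisjoint T T′ → EdgeDisjoint T′ T
edgeDisjoint-sym T#T′ e∈ f∈ = distinctEdges-sym (T#T′ f∈ e∈)

allPairs-++⁻ : ∀ {A : Set} {R : Rel A 0ℓ} xs {ys} → AllPairs R (xs ++ ys) →
               (∀ {x y} → x ∈ₗ xs → y ∈ₗ ys → R x y) × AllPairs R ys
allPairs-++⁻ [] r = (λ ()) , r
allPairs-++⁻ (x ∷ xs) (x~ ∷ r) with allPairs-++⁻ xs r
... | xs~ys , rys = (λ { (here refl) y∈ → All.lookup x~ (∈-++⁺ʳ xs y∈)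
                       ; (there x∈)  y∈ → xs~ys x∈ y∈ }) , rys

-- Each peeled trail lowers the value of the flow by one. It shares no edge with the arcs left over,
-- and all later trails are drawn from those.
decompose-flow : ∀ {x y : Fin n} m L → AllPairs DistinctEdges L →
  Balanced L (replicate m y) (replicate m x) →
  ∃ λ (T : Fin m → List (Fin n × Fin n)) → (∀ i → Star (Joined (T i)) x y)
    × (∀ i {e} → e ∈ₗ T i → e ∈ₗ L) × (∀ i j → i ≢ j → EdgeDisjoint (T i) (T j))
-- The arcs still present form a circulation and are discarded.
decompose-flow zero L _ _ = (λ ()) , (λ ()) , (λ ()) , λ ()
decompose-flow {n} {x} {y} (suc m) L distinct bal with peel-trail m (length L) x L refl bal
... | T₀ , L′ , L↭ , walk , bal′ with allPairs-++⁻ T₀ (allDistinct-↭ L↭ distinct)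
...   | T₀#L′ , distinct′ with decompose-flow m L′ distinct′ bal′
...     | T , walks , T⊆L′ , T#T = Ts , walks′ , Ts⊆L , Ts#Ts
  where
  Ts : Fin (suc m) → List (Fin n × Fin n)
  Ts zero    = T₀
  Ts (suc i) = T i
  walks′ : ∀ i → Star (Joined (Ts i)) x y
  walks′ zero    = walk
  walks′ (suc i) = walks i
  Ts⊆L : ∀ i {e} → e ∈ₗ Ts i → e ∈ₗ L
  Ts⊆L zero    e∈ = ∈-resp-↭ (↭-sym L↭) (∈-++⁺ˡ e∈)
  Ts⊆L (suc i) e∈ = ∈-resp-↭ (↭-sym L↭) (∈-++⁺ʳ T₀ (T⊆L′ i e∈))
  Ts#Ts : ∀ i j → i ≢ j → EdgeDisjoint (Ts i) (Ts j)
  Ts#Ts zero    zero    0≢0 = contradiction refl 0≢0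
  Ts#Ts zero    (suc j) _   = λ e∈ f∈ → T₀#L′ e∈ (T⊆L′ j f∈)
  Ts#Ts (suc i) zero    _   = edgeDisjoint-sym (λ e∈ f∈ → T₀#L′ e∈ (T⊆L′ i f∈))
  Ts#Ts (suc i) (suc j) i≢j = T#T i j (i≢j ∘ cong suc)

-- Two-element sets and equality for `k` equal to 2

no-members : (S : Subset n) → ∣ S ∣ ≡ 0 → ∀ {z} → ¬ z ∈ S
no-members (false ∷ S) eq (there z∈) = no-members S eq z∈

sole-member : (S : Subset n) → ∣ S ∣ ≡ 1 → ∃ λ x → x ∈ S × (∀ {z} → z ∈ S → z ≡ x)
sole-member (true ∷ S) eq = zero , here ,
  λ { here → refl ; (there z∈) → contradiction z∈ (no-members S (suc-injective eq)) }
sole-member (false ∷ S) eq with sole-member S eq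
... | x , x∈ , only = suc x , there x∈ , λ { (there z∈) → cong suc (only z∈) }

both-members : (S : Subset n) → ∣ S ∣ ≡ 2 →
               ∃ λ x → ∃ λ y → x ∈ S × y ∈ S × (∀ {z} → z ∈ S → z ≡ x ⊎ z ≡ y)
both-members (true ∷ S) eq with sole-member S (suc-injective eq)
... | y , y∈ , only = zero , suc y , here , there y∈ ,
  λ { here → inj₁ refl ; (there z∈) → inj₂ (cong suc (only z∈)) }
both-members (false ∷ S) eq with both-members S eq
... | x , y , x∈ , y∈ , only = suc x , suc y , there x∈ , there y∈ ,
  λ { (there z∈) → Sum.map (cong suc) (cong suc) (only z∈) }

strong⇒tree-packing : (G : Graph n) (S : Subset n) → ∣ S ∣ ≡ 2 →
  Packing (IsStrongSubgraph (symmetricDigraph G) S) m → Packing (IsSTree G S) m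
strong⇒tree-packing {n} {m} G S ∣S∣≡2 (H , Hs-strong , disjoint) with both-members S ∣S∣≡2
... | x , y , x∈S , y∈S , only
  with flow-of-packing m H
         (λ i → let open IsStrongSubgraph (Hs-strong i) in
                strong x y (contains x∈S) (contains y∈S))
         disjoint
... | L , unique , L⊆H , bal with cancel-opposite L unique
... | L′ , distinct , L′⊆L , preserve with decompose-flow m L′ distinct (preserve bal)
... | T , walks , T⊆L′ , T#T = RootedTree.asSub ∘ tree , isTree , trees-disjoint
  where
  -- A trail repeats no edge but may revisit vertices, so loops are erased again before it is read
  -- as a tree.
  path : ∀ i → ∃ (SimplePath (Joined (T i)) y x)
  path i = erase-loops (walks i)

  tree : Fin m → RootedTree n
  tree i = pathTree (proj₂ (path i))

  T⊆G : ∀ i {a b} → (a , b) ∈ₗ T i → a ⟶ b ∈ Graph.edges G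
  T⊆G i e∈ with L⊆H (L′⊆L (T⊆L′ i e∈))
  ... | j , arc = _IsSubgraphOf_.arcs⊆ (IsStrongSubgraph.subgraph (Hs-strong j)) _ _ arc

  isTree : ∀ i → IsSTree G S (RootedTree.asSub (tree i))
  isTree i = RootedTree.rootedTree-isSTree (tree i) G
    (T⊆G i ∘ path⊆ (proj₂ (path i)))
    (S-vertex ∘ only)
    where
    S-vertex : ∀ {z} → z ≡ x ⊎ z ≡ y → z ∈ₗ y ∷ tails (proj₁ (path i))
    S-vertex (inj₁ refl) = start-vertex (proj₂ (path i))
    S-vertex (inj₂ z≡y)  = here z≡y

  trees-disjoint : ∀ i j → i ≢ j →
                   Disjoint (RootedTree.asSub (tree i)) (RootedTree.asSub (tree j))
  trees-disjoint i j i≢j a b e f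
    with arcsOf⁻ (RootedTree.edge? (tree i)) e | arcsOf⁻ (RootedTree.edge? (tree j)) f
  -- A tree contains both orientations of each arc of its path. A common arc of two trees thus comes
  -- from path arcs that agree or are opposite, and `DistinctEdges` excludes both.
  ... | inj₁ p | inj₁ q = proj₁ (T#T i j i≢j (path⊆ (proj₂ (path i)) p) (path⊆ (proj₂ (path j)) q)) refl
  ... | inj₁ p | inj₂ q = proj₂ (T#T i j i≢j (path⊆ (proj₂ (path i)) p) (path⊆ (proj₂ (path j)) q)) refl
  ... | inj₂ p | inj₁ q = proj₂ (T#T i j i≢j (path⊆ (proj₂ (path i)) p) (path⊆ (proj₂ (path j)) q)) refl
  ... | inj₂ p | inj₂ q = proj₁ (T#T i j i≢j (path⊆ (proj₂ (path i)) p) (path⊆ (proj₂ (path j)) q)) refl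

λᵈ₂≤λᵍ₂ : (G : Graph n) (2≤n : 2 ≤ n) →
          λᵈ (symmetricDigraph G) 2 ≤-refl 2≤n ≤ λᵍ G 2 ≤-refl 2≤n
λᵈ₂≤λᵍ₂ G 2≤n = λ-k-mono (IsStrongSubgraph (symmetricDigraph G)) (IsSTree G)
  (λ-S-strong-exists ≤-refl (symmetricDigraph G))
  (λ S ∣S∣≡2 → strong⇒tree-packing G S ∣S∣≡2)
  (λᵈ-spec (symmetricDigraph G) 2 ≤-refl 2≤n) (λᵍ-spec G 2 ≤-refl 2≤n)

theorem4p6 : (∀ (n : ℕ) (G : Graph n) (k : ℕ) (2≤k : 2 ≤ k) (k≤n : k ≤ n) →
    λᵈ (symmetricDigraph G) k 2≤k k≤n ≥ λᵍ G k 2≤k k≤n)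
    × (∀ (n k : ℕ) (2≤k : 2 ≤ k) (k≤n : k ≤ n) →
    ∃ λ (G : Graph n) →
    1 ≤ λᵍ G k 2≤k k≤n
    × λᵈ (symmetricDigraph G) k 2≤k k≤n ≡ λᵍ G k 2≤k k≤n)
    × (∀ (n : ℕ) (G : Graph n) (2≤n : 2 ≤ n) →
    λᵈ (symmetricDigraph G) 2 ≤-refl 2≤n ≡ λᵍ G 2 ≤-refl 2≤n)
theorem4p6 = (λ n → λᵍ≤λᵈ)
  -- The star needs a centre; order 0 is impossible because `k` is at least 2.
  , (λ { zero k 2≤k k≤n → contradiction (≤-trans 2≤k k≤n) λ ()
       ; (suc n) k 2≤k k≤n → starGraph n , 1≤λᵍ-star n k 2≤k k≤n , λᵈ-star≡λᵍ-star n k 2≤k k≤n })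
  , (λ n G 2≤n → ≤-antisym (λᵈ₂≤λᵍ₂ G 2≤n) (λᵍ≤λᵈ G 2 ≤-refl 2≤n))
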